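{- Let $\mathsf T$ be a finite nonempty set of homogeneous terms and $\mathsf D$ a finite set of formulas of the form $d\mid t$ with $d\geq 1$ and $t$ a homogeneous term, all terms using variables among $y_1,\dots,y_r$. Let $\ell>\max(\{\|t\|_+ : t\in\mathsf T\}\cup\{\|t\|_-:t\in\mathsf T\})$ and $\ell'>\max\{d : d\mid t\in\mathsf D\}$ be integers. Let $\psi$ be a Boolean combination of atomic formulas $t\bowtie c$ and $d\mid t+c'$ where $t\in\mathsf T$ (in the first kind), $d\mid t\in\mathsf D$ (in the second kind), $c,c'\in\mathbb Z$ with $-\ell<c<\ell$, and $\bowtie\in\{=,\neq,<,\leq,>,\geq\}$. Then the minimal deterministic word automaton representing $\{\bar a\in\mathbb{Z}^r:(\mathbb{Z},<,+)\models\psi[\bar a]\}$ has at most $(2+2\ell)^{|\mathsf T|}\cdot \ell'^{|\mathsf D|}$ states.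
   Context: A term is homogeneous if it is $0$ or of the form $k_1\cdot x_1+\dots+k_m\cdot x_m$ with pairwise distinct variables and nonzero integer coefficients $k_i$. For such $t$, $\|t\|_-=\sum_{k_j<0}|k_j|$ and $\|t\|_+=\sum_{k_j>0}k_j$. Encoding: fix an integer base $\varrho\geq 2$ and $\Sigma=\{0,\dots,\varrho-1\}$. For $b_{n-1}\dots b_0\in\Sigma^*$ let $\langle b_{n-1}\dots b_0\rangle_{\mathbb N}=\sum_{i<n}\varrho^i b_i$; for $b_nb_{n-1}\dots b_0\in\Sigma^+$ let $\langle b_n\dots b_0\rangle_{\mathbb Z}=\langle b_{n-1}\dots b_0\rangle_{\mathbb N}$ if $b_n=0$ and $\langle b_{n-1}\dots b_0\rangle_{\mathbb N}-\varrho^n$ if $b_n\neq 0$. Words over $\Sigma^r$ are read componentwise (track $i$ encodes the value of $y_i$), giving $\langle w\rangle_{\mathbb Z}\in\mathbb{Z}^r$ for $w\in(\Sigma^r)^+$. A deterministic word automaton $\mathcal A$ over $\Sigma^r$ represents $U\subseteq\mathbb{Z}^r$ if $L(\mathcal A)=\{w\in(\Sigma^r)^+:\langle w\rangle_{\mathbb Z}\in U\}$. -}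

module Defs where

open import Data.Nat as ℕ using (ℕ; zero; suc)
open import Data.Integer as ℤ using (ℤ; +_; -_)
open import Data.Integer.Divisibility using (_∣_)
open import Data.Fin using (Fin; toℕ)
open import Data.Vec using (Vec; []; _∷_; lookup; map; zipWith)
open import Data.List as List using (List; []; _∷_; length; foldl)
open import Data.Bool using (Bool; true; false)
open import Data.Product using (_×_; Σ; ∃; ∃-syntax; _,_)
open import Data.Sum using (_⊎_)
open import Data.Empty using (⊥)
open import Relation.Nullary using (¬_)
open import Relation.Binary.PropositionalEquality using (_≡_; _≢_)
open import Function.Bundles using (_⇔_)
open import Data.List.Membership.Propositional using (_∈_)

-- Homogeneous terms in the variables y_1 … y_r.
-- A homogeneous term k_1·x_1+…+k_m·x_m (distinct variables, nonzero
-- coefficients) over y_1..y_r is represented by its coefficient vector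
-- (coefficient 0 = variable absent; all-zero vector = the term 0).
-- This representation is a bijection with homogeneous terms.

Term : ℕ → Set
Term r = Vec ℤ r

sumℤ : ∀ {n} → Vec ℤ n → ℤ
sumℤ []       = + 0
sumℤ (x ∷ xs) = x ℤ.+ sumℤ xs

evalT : ∀ {r} → Term r → Vec ℤ r → ℤ
evalT t a = sumℤ (zipWith ℤ._*_ t a)

posPart : ℤ → ℤ
posPart (+ n)      = + n
posPart ℤ.-[1+ n ] = + 0

negPart : ℤ → ℤ
negPart (+ n)      = + 0
negPart ℤ.-[1+ n ] = + suc n

‖_‖₊ : ∀ {r} → Term r → ℤ
‖ t ‖₊ = sumℤ (map posPart t)

‖_‖₋ : ∀ {r} → Term r → ℤ
‖ t ‖₋ = sumℤ (map negPart t)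

data Rel : Set where
  eq ne lt le gt ge : Rel

data Formula (r : ℕ) : Set where
  cmp  : Term r → Rel → ℤ → Formula r
  dvd  : ℕ → Term r → ℤ → Formula r
  ¬ᶠ_  : Formula r → Formula r
  _∧ᶠ_ : Formula r → Formula r → Formula r
  _∨ᶠ_ : Formula r → Formula r → Formula r

⟦_⟧ʳ : Rel → ℤ → ℤ → Set
⟦ eq ⟧ʳ x y = x ≡ y
⟦ ne ⟧ʳ x y = x ≢ y
⟦ lt ⟧ʳ x y = x ℤ.< y
⟦ le ⟧ʳ x y = x ℤ.≤ y
⟦ gt ⟧ʳ x y = x ℤ.> y
⟦ ge ⟧ʳ x y = x ℤ.≥ y

_⊨_ : ∀ {r} → Vec ℤ r → Formula r → Set
a ⊨ cmp t ⋈ c   = ⟦ ⋈ ⟧ʳ (evalT t a) c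
a ⊨ dvd d t c'  = (+ d) ∣ (evalT t a ℤ.+ c')
a ⊨ (¬ᶠ φ)      = ¬ (a ⊨ φ)
a ⊨ (φ ∧ᶠ χ)    = (a ⊨ φ) × (a ⊨ χ)
a ⊨ (φ ∨ᶠ χ)    = (a ⊨ φ) ⊎ (a ⊨ χ)

data WellFormed {r : ℕ} (T : List (Term r)) (D : List (ℕ × Term r)) (ℓ : ℤ)
       : Formula r → Set where
  cmp : ∀ {t ⋈ c} → t ∈ T → (- ℓ) ℤ.< c → c ℤ.< ℓ → WellFormed T D ℓ (cmp t ⋈ c)
  dvd : ∀ {d t c'} → (d , t) ∈ D → WellFormed T D ℓ (dvd d t c')
  ¬ᶠ_ : ∀ {φ} → WellFormed T D ℓ φ → WellFormed T D ℓ (¬ᶠ φ)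
  _∧ᶠ_ : ∀ {φ χ} → WellFormed T D ℓ φ → WellFormed T D ℓ χ → WellFormed T D ℓ (φ ∧ᶠ χ)
  _∨ᶠ_ : ∀ {φ χ} → WellFormed T D ℓ φ → WellFormed T D ℓ χ → WellFormed T D ℓ (φ ∨ᶠ χ)

-- Encoding in base ϱ.  Σ = Fin ϱ; letters of Σ^r are Vec (Fin ϱ) r.
-- Words are lists, read left to right: the first letter is the most
-- significant digit b_n.

⟨_⟩ℕ : ∀ {ϱ} → List (Fin ϱ) → ℕ
⟨_⟩ℕ {ϱ} = foldl (λ acc b → acc ℕ.* ϱ ℕ.+ toℕ b) 0

⟨_∷_⟩ℤ : ∀ {ϱ} → Fin ϱ → List (Fin ϱ) → ℤ
⟨_∷_⟩ℤ {ϱ} bn rest with toℕ bn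
... | zero  = + ⟨ rest ⟩ℕ
... | suc _ = + ⟨ rest ⟩ℕ ℤ.- + (ϱ ℕ.^ length rest)

decode : ∀ {ϱ r} → Vec (Fin ϱ) r → List (Vec (Fin ϱ) r) → Vec ℤ r
decode {r = r} x xs = go (Data.Vec.allFin r)
  where
  go : ∀ {m} → Vec (Fin r) m → Vec ℤ m
  go []       = []
  go (i ∷ is) = ⟨ lookup x i ∷ List.map (λ y → lookup y i) xs ⟩ℤ ∷ go is

record DFA (A : Set) (Q : Set) : Set where
  field
    init  : Q
    δ     : Q → A → Q
    final : Q → Bool

  run : Q → List A → Q
  run q []       = q
  run q (a ∷ w)  = run (δ q a) w

  accepts : List A → Set
  accepts w = final (run init w) ≡ true

Represents : ∀ {ϱ r Q} → DFA (Vec (Fin ϱ) r) Q → (Vec ℤ r → Set) → Set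
Represents 𝒜 U =
  (¬ DFA.accepts 𝒜 [])
  × (∀ x xs → DFA.accepts 𝒜 (x ∷ xs) ⇔ U (decode x xs))

-- The minimal DFA representing U has at most N states, i.e. some DFA
-- representing U has a number k ≤ N of states (states = Fin k).
MinDFAStatesAtMost : (ϱ r : ℕ) → (Vec ℤ r → Set) → ℤ → Set
MinDFAStatesAtMost ϱ r U N =
  ∃[ k ] Σ (DFA (Vec (Fin ϱ) r) (Fin k)) (λ 𝒜 → Represents 𝒜 U × (+ k) ℤ.≤ N)

{-# OPTIONS --safe #-}
-- Appending a letter y turns the value v of a term t into ϱ v + e with
-- -(ϱ - 1) ‖t‖₋ ≤ e ≤ (ϱ - 1) ‖t‖₊. Hence a value outside (-ℓ, ℓ) stays outside, on the
-- same side, and it suffices to remember the value of each t ∈ T clamped to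
-- [-ℓ, ℓ], and the residue modulo d for each d ∣ t ∈ D. With the initial
-- state this gives 1 + (1 + 2ℓ)^|T| · ∏ d states; the 1 is absorbed by
-- (1 + 2ℓ)^|T| < (2 + 2ℓ)^|T|, which needs T nonempty.
module Submission where

open import Defs
open import Data.Nat using (ℕ; _≥_)
open import Data.Integer using (ℤ; +_; _<_; _+_; _*_; _^_)
open import Data.List using (List; []; length)
open import Data.List.Relation.Unary.Unique.Propositional using (Unique)
open import Data.List.Membership.Propositional using (_∈_)
open import Data.Product using (_×_; _,_)
open import Relation.Binary.PropositionalEquality using (_≢_)

open import Data.Bool using (Bool; true; false; not; _∧_; _∨_)
open import Data.Fin using (Fin; zero; suc; toℕ; fromℕ; fromℕ<; combine; remQuot)
open import Data.Fin.Properties using (toℕ≤pred[n]; toℕ-fromℕ; toℕ-fromℕ<; toℕ-injective; fromℕ<-cong; remQuot-combine)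
open import Data.Integer using (-[1+_]; -_; _-_; _≤_; ∣_∣; +≤+; +<+)
open import Data.Integer.DivMod using (_%ℕ_; _/ℕ_; n%ℕd<d; a≡a%ℕn+[a/ℕn]*n)
open import Data.Integer.Divisibility.Signed using (_∣_; _∣?_; divides; ∣ᵤ⇒∣; ∣⇒∣ᵤ; ∣m∣n⇒∣m+n; ∣m∣n⇒∣m-n; ∣n⇒∣m*n)
open import Data.Integer.Tactic.RingSolver using (solve-∀)
open import Data.List using (_∷_; _++_; foldl; map)
open import Data.List.Membership.Propositional.Properties using (∈-map⁺; ∈-++⁺ˡ; ∈-++⁺ʳ)
open import Data.List.Properties using (map-++)
open import Data.List.Relation.Unary.All as All using (All; []; _∷_)
open import Data.List.Relation.Unary.All.Properties using (map⁺; ++⁺)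
open import Data.List.Relation.Unary.Any using (here; there)
open import Data.Nat as ℕ using (zero; suc; z≤n; s≤s)
open import Data.Nat.ListAction using (product)
open import Data.Nat.ListAction.Properties using (product-++)
open import Data.Product using (proj₁; proj₂; map₁)
open import Data.Vec as Vec using (Vec; []; _∷_; lookup; allFin)
open import Data.Vec.Properties using (map-cong; map-lookup-allFin)
open import Function using (_∘_)
open import Function.Bundles using (_⇔_; mk⇔; module Equivalence)
open import Relation.Binary.PropositionalEquality using (_≡_; refl; sym; trans; cong; cong₂; subst; module ≡-Reasoning)
open import Relation.Nullary using (Dec; yes; no; does; proof; ¬?; contradiction)
open import Relation.Nullary.Decidable using (map′)
open import Relation.Nullary.Reflects using (Reflects; ofʸ; ofⁿ; ¬-reflects; _×-reflects_; _⊎-reflects_)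
import Data.Integer as ℤ
import Data.Integer.Properties as ℤ
import Data.Nat.Divisibility as ℕ
import Data.Nat.Properties as ℕ

-- Decoding by Horner's rule

horner : ∀ {ϱ} → ℤ → Fin ϱ → ℤ
horner {ϱ} v b = + ϱ * v + + toℕ b

step : ∀ {ϱ r} → Vec ℤ r → Vec (Fin ϱ) r → Vec ℤ r
step = Vec.zipWith horner

digits : ∀ {ϱ r} → List (Vec (Fin ϱ) r) → Fin r → List (Fin ϱ)
digits xs i = map (λ y → lookup y i) xs

track : ∀ {ϱ r} → Vec (Fin ϱ) r → List (Vec (Fin ϱ) r) → Fin r → ℤ
track x xs i = ⟨ lookup x i ∷ digits xs i ⟩ℤ

-- The left-hand side is the local function go of decode, which cannot be
-- named here: unification finds it at the use in tail-decode, where the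
-- with-abstraction tells apart the number of tracks and the length of is.
go-map : ∀ {ϱ r m} (x : Vec (Fin ϱ) r) xs (is : Vec (Fin r) m) →
         _ ≡ Vec.map (track x xs) is

tail-decode : ∀ {ϱ r} (x : Vec (Fin ϱ) (suc r)) xs →
              Vec.tail (decode x xs) ≡ Vec.map (track x xs) (Vec.tabulate suc)
tail-decode {r = r} x xs with Vec.tabulate {A = Fin (suc r)} (suc {n = r})
... | is with suc r | x | xs | is
...   | _ | x′ | xs′ | is′ = go-map x′ xs′ is′

go-map x xs []       = refl
go-map x xs (i ∷ is) = cong (track x xs i ∷_) (go-map x xs is)

decode-track : ∀ {ϱ r} (x : Vec (Fin ϱ) r) xs →
               decode x xs ≡ Vec.map (track x xs) (allFin r)
decode-track {r = zero}  x xs = refl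
decode-track {r = suc r} x xs = cong (track x xs zero ∷_) (tail-decode x xs)

foldl-horner-ℕ : ∀ {ϱ} m (bs : List (Fin ϱ)) →
                 foldl horner (+ m) bs ≡ + foldl (λ acc b → acc ℕ.* ϱ ℕ.+ toℕ b) m bs
foldl-horner-ℕ m [] = refl
foldl-horner-ℕ {ϱ} m (b ∷ bs) = begin
  foldl horner (+ ϱ * + m + + toℕ b) bs  ≡⟨ cong (λ v → foldl horner v bs) eq₁ ⟩
  foldl horner (+ (m ℕ.* ϱ ℕ.+ toℕ b)) bs  ≡⟨ foldl-horner-ℕ (m ℕ.* ϱ ℕ.+ toℕ b) bs ⟩
  _ ∎
  where
  open ≡-Reasoning
  eq₁ : + ϱ * + m + + toℕ b ≡ + (m ℕ.* ϱ ℕ.+ toℕ b)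
  eq₁ = cong (_+ + toℕ b) (trans (sym (ℤ.pos-* ϱ m)) (cong +_ (ℕ.*-comm ϱ m)))

-- Each digit multiplies the part `w` of the starting value by `ϱ`. With `u = 0` and `w = 1` this
-- yields the summand of a nonzero leading digit.
foldl-horner-minus : ∀ {ϱ} u w (bs : List (Fin ϱ)) →
                     foldl horner (u - w) bs ≡ foldl horner u bs - w * + (ϱ ℕ.^ length bs)
foldl-horner-minus u w [] = cong (λ z → u - z) (sym (ℤ.*-identityʳ w))
foldl-horner-minus {ϱ} u w (b ∷ bs) = begin
  foldl horner (+ ϱ * (u - w) + β) bs
    ≡⟨ cong (λ z → foldl horner z bs) (shift (+ ϱ) u w β) ⟩
  foldl horner (+ ϱ * u + β - + ϱ * w) bs
    ≡⟨ foldl-horner-minus (+ ϱ * u + β) (+ ϱ * w) bs ⟩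
  U - + ϱ * w * + (ϱ ℕ.^ length bs)
    ≡⟨ cong (λ z → U - z) (rotate (+ ϱ) w (+ (ϱ ℕ.^ length bs))) ⟩
  U - w * (+ ϱ * + (ϱ ℕ.^ length bs))
    ≡⟨ cong (λ z → U - w * z) (ℤ.pos-* ϱ (ϱ ℕ.^ length bs)) ⟨
  U - w * + (ϱ ℕ.* ϱ ℕ.^ length bs) ∎
  where
  open ≡-Reasoning
  β = + toℕ b
  U = foldl horner (+ ϱ * u + β) bs
  shift : ∀ p u w β → p * (u - w) + β ≡ p * u + β - p * w
  shift = solve-∀
  rotate : ∀ p w z → p * w * z ≡ w * (p * z)
  rotate = solve-∀

-- A leading digit alone has the value 0 or `0 - ϱ ^ 0 = -1`. Started from there, Horner's rule
-- treats all later digits alike, whatever the sign.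
⟨⟩ℤ-horner : ∀ {ϱ} (b : Fin ϱ) bs → ⟨ b ∷ bs ⟩ℤ ≡ foldl horner ⟨ b ∷ [] ⟩ℤ bs
⟨⟩ℤ-horner {ϱ} b bs with toℕ b
... | zero  = sym (foldl-horner-ℕ 0 bs)
... | suc _ = begin
  + ⟨ bs ⟩ℕ - + (ϱ ℕ.^ length bs)
    ≡⟨ cong₂ _-_ (foldl-horner-ℕ 0 bs) (ℤ.*-identityˡ (+ (ϱ ℕ.^ length bs))) ⟨
  foldl horner (+ 0) bs - + 1 * + (ϱ ℕ.^ length bs)
    ≡⟨ foldl-horner-minus (+ 0) (+ 1) bs ⟨
  foldl horner (+ 0 - + 1) bs ∎
  where open ≡-Reasoning

zipWith-map-allFin : ∀ {ϱ r m} (g : Fin r → ℤ) (y : Vec (Fin ϱ) r) (is : Vec (Fin r) m) →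
                     Vec.zipWith horner (Vec.map g is) (Vec.map (lookup y) is)
                       ≡ Vec.map (λ i → horner (g i) (lookup y i)) is
zipWith-map-allFin g y []       = refl
zipWith-map-allFin g y (i ∷ is) = cong (_ ∷_) (zipWith-map-allFin g y is)

foldl-step : ∀ {ϱ r} (g : Fin r → ℤ) (xs : List (Vec (Fin ϱ) r)) →
             foldl step (Vec.map g (allFin r)) xs
               ≡ Vec.map (λ i → foldl horner (g i) (digits xs i)) (allFin r)
foldl-step g [] = refl
foldl-step {r = r} g (y ∷ xs) = begin
  foldl step (step (Vec.map g (allFin r)) y) xs
    ≡⟨ cong (λ z → foldl step (step (Vec.map g (allFin r)) z) xs) (map-lookup-allFin y) ⟨
  foldl step (step (Vec.map g (allFin r)) (Vec.map (lookup y) (allFin r))) xs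
    ≡⟨ cong (λ a → foldl step a xs) (zipWith-map-allFin g y (allFin r)) ⟩
  foldl step (Vec.map (λ i → horner (g i) (lookup y i)) (allFin r)) xs
    ≡⟨ foldl-step (λ i → horner (g i) (lookup y i)) xs ⟩
  _ ∎
  where open ≡-Reasoning

-- The first letter supplies the starting values and every further letter acts by `step`; the run of
-- an automaton can follow this fold letter by letter.
decode-foldl : ∀ {ϱ r} (x : Vec (Fin ϱ) r) xs → decode x xs ≡ foldl step (decode x []) xs
decode-foldl {r = r} x xs = begin
  decode x xs
    ≡⟨ decode-track x xs ⟩
  Vec.map (track x xs) (allFin r)
    ≡⟨ map-cong (λ i → ⟨⟩ℤ-horner (lookup x i) (digits xs i)) (allFin r) ⟩
  Vec.map (λ i → foldl horner (track x [] i) (digits xs i)) (allFin r)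
    ≡⟨ foldl-step (track x []) xs ⟨
  foldl step (Vec.map (track x []) (allFin r)) xs
    ≡⟨ cong (λ a → foldl step a xs) (decode-track x []) ⟨
  foldl step (decode x []) xs ∎
  where
  open ≡-Reasoning

-- The weight of a letter

weight : ∀ {ϱ r} → Term r → Vec (Fin ϱ) r → ℤ
weight t y = evalT t (Vec.map (+_ ∘ toℕ) y)

evalT-step : ∀ {ϱ r} (t : Term r) a (y : Vec (Fin ϱ) r) →
             evalT t (step a y) ≡ + ϱ * evalT t a + weight t y
evalT-step {ϱ} [] [] [] = sym (trans (ℤ.+-identityʳ _) (ℤ.*-zeroʳ (+ ϱ)))
evalT-step {ϱ} (k ∷ t) (v ∷ a) (b ∷ y) =
  trans (cong (λ z → k * (+ ϱ * v + + toℕ b) + z) (evalT-step t a y))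
        (regroup k (+ ϱ) v (+ toℕ b) (evalT t a) (weight t y))
  where
  regroup : ∀ k p v b e w → k * (p * v + b) + (p * e + w) ≡ p * (k * v + e) + (k * b + w)
  regroup = solve-∀

module _ {c : ℕ} where

  -- The base is `suc c`, so the largest digit is `c`. A positive coefficient contributes most at
  -- the digit `c`, a negative one at the digit 0; for the lower bound these roles are exchanged.
  *-digit-≤ : ∀ k (b : Fin (suc c)) → k * + toℕ b ≤ + c * posPart k
  *-digit-≤ (+ m) b = subst (+ m * + toℕ b ≤_) (ℤ.*-comm (+ m) (+ c))
    (ℤ.*-monoˡ-≤-nonNeg (+ m) (+≤+ (toℕ≤pred[n] b)))
  *-digit-≤ -[1+ m ] b = subst (-[1+ m ] * + toℕ b ≤_)
    (trans (ℤ.*-zeroʳ -[1+ m ]) (sym (ℤ.*-zeroʳ (+ c))))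
    (ℤ.*-monoˡ-≤-nonPos -[1+ m ] (+≤+ z≤n))

  *-digit-≥ : ∀ k (b : Fin (suc c)) → - (+ c * negPart k) ≤ k * + toℕ b
  *-digit-≥ (+ m) b = subst (_≤ + m * + toℕ b)
    (trans (ℤ.*-zeroʳ (+ m)) (sym (cong -_ (ℤ.*-zeroʳ (+ c)))))
    (ℤ.*-monoˡ-≤-nonNeg (+ m) (+≤+ z≤n))
  *-digit-≥ -[1+ m ] b = subst (_≤ -[1+ m ] * + toℕ b)
    (trans (sym (ℤ.neg-distribˡ-* (+ suc m) (+ c))) (cong -_ (ℤ.*-comm (+ suc m) (+ c))))
    (ℤ.*-monoˡ-≤-nonPos -[1+ m ] (+≤+ (toℕ≤pred[n] b)))

  weight-≤ : ∀ {r} (t : Term r) (y : Vec (Fin (suc c)) r) → weight t y ≤ + c * ‖ t ‖₊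
  weight-≤ []      []      = ℤ.≤-reflexive (sym (ℤ.*-zeroʳ (+ c)))
  weight-≤ (k ∷ t) (b ∷ y) = subst (weight (k ∷ t) (b ∷ y) ≤_)
    (sym (ℤ.*-distribˡ-+ (+ c) (posPart k) ‖ t ‖₊))
    (ℤ.+-mono-≤ (*-digit-≤ k b) (weight-≤ t y))

  weight-≥ : ∀ {r} (t : Term r) (y : Vec (Fin (suc c)) r) → - (+ c * ‖ t ‖₋) ≤ weight t y
  weight-≥ []      []      = ℤ.≤-reflexive (cong -_ (ℤ.*-zeroʳ (+ c)))
  weight-≥ (k ∷ t) (b ∷ y) = subst (_≤ weight (k ∷ t) (b ∷ y))
    (neg-distrib (+ c) (negPart k) ‖ t ‖₋)
    (ℤ.+-mono-≤ (*-digit-≥ k b) (weight-≥ t y))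
    where
    neg-distrib : ∀ p u v → - (p * u) + - (p * v) ≡ - (p * (u + v))
    neg-distrib = solve-∀

-- Finite abstractions of the integers

-- `rep` chooses an integer to stand for each class, so that transitions and acceptance can be
-- computed on integers. The laws relating it to `abs` are proved for each abstraction separately.
record Abstraction : Set where
  field
    size : ℕ
    abs  : ℤ → Fin size
    rep  : Fin size → ℤ

open Abstraction

-- Automata tracking the classes of finitely many terms

Tracker : ℕ → Set
Tracker r = Abstraction × Term r

-- The congruence property behind the transition function: the class after a letter depends only on
-- the class before it.
Compatible : ∀ {r} → ℕ → Tracker r → Set
Compatible {r} ϱ (A , t) = ∀ v (y : Vec (Fin ϱ) r) →
  abs A (+ ϱ * rep A (abs A v) + weight t y) ≡ abs A (+ ϱ * v + weight t y)

states : ∀ {r} → List (Tracker r) → ℕ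
states L = product (map (size ∘ proj₁) L)

summary : ∀ {r} (L : List (Tracker r)) → Vec ℤ r → Fin (states L)
summary []            a = zero
summary ((A , t) ∷ L) a = combine (abs A (evalT t a)) (summary L a)

update : ∀ {ϱ r} (L : List (Tracker r)) → Vec (Fin ϱ) r → Fin (states L) → Fin (states L)
update []                    y q = zero
update {ϱ} ((A , t) ∷ L) y q = let (i , q′) = remQuot (states L) q in
  combine (abs A (+ ϱ * rep A i + weight t y)) (update L y q′)

update-summary : ∀ {ϱ r} {L : List (Tracker r)} → All (Compatible ϱ) L → ∀ y a →
                 update L y (summary L a) ≡ summary L (step {ϱ} a y)
update-summary [] y a = refl
update-summary {ϱ} {L = (A , t) ∷ L} (comp ∷ comps) y a
  = trans
      (cong (λ (i , q) → combine (abs A (+ ϱ * rep A i + weight t y)) (update L y q))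
            (remQuot-combine (abs A (evalT t a)) (summary L a)))
      (cong₂ combine (trans (comp (evalT t a) y) (cong (abs A) (sym (evalT-step t a y))))
                     (update-summary comps y a))

-- The membership proof serves as the index of the component to be unpacked.
observe : ∀ {r} {L : List (Tracker r)} {τ} → τ ∈ L → Fin (states L) → ℤ
observe {L = (A , _) ∷ L} (here _)  q = rep A (proj₁ (remQuot (states L) q))
observe {L = (A , _) ∷ L} (there m) q = observe m (proj₂ (remQuot {size A} (states L) q))

observe-summary : ∀ {r} {L : List (Tracker r)} {A t} (m : (A , t) ∈ L) a →
                  observe m (summary L a) ≡ rep A (abs A (evalT t a))
observe-summary {L = (A , t) ∷ L} (here refl) a
  = cong (rep A ∘ proj₁) (remQuot-combine (abs A (evalT t a)) (summary L a))
observe-summary {L = (A , t) ∷ L} (there m) a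
  = trans (cong (observe m ∘ proj₂) (remQuot-combine (abs A (evalT t a)) (summary L a)))
          (observe-summary m a)

-- The extra state `zero` stands for the empty word: it rejects, and it is where the first letter is
-- decoded by the sign rule instead of being appended.
trackerDFA : ∀ {ϱ r} (L : List (Tracker r)) → (Fin (states L) → Bool) →
             DFA (Vec (Fin ϱ) r) (Fin (suc (states L)))
trackerDFA L accept = record
  { init  = zero
  ; δ     = λ { zero x → suc (summary L (decode x [])) ; (suc q) x → suc (update L x q) }
  ; final = λ { zero → false ; (suc q) → accept q }
  }

run-summary : ∀ {ϱ r} {L : List (Tracker r)} accept → All (Compatible ϱ) L → ∀ xs a →
              DFA.run (trackerDFA {ϱ} L accept) (suc (summary L a)) xs
                ≡ suc (summary L (foldl step a xs))
run-summary accept comps [] a = refl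
run-summary {L = L} accept comps (x ∷ xs) a
  rewrite update-summary comps x a = run-summary accept comps xs (step a x)

reflects-≡true : ∀ {P : Set} {b} → Reflects P b → b ≡ true ⇔ P
reflects-≡true (ofʸ p)  = mk⇔ (λ _ → p) (λ _ → refl)
reflects-≡true (ofⁿ ¬p) = mk⇔ (λ ()) (λ p → contradiction p ¬p)

trackerDFA-represents : ∀ {ϱ r} {L : List (Tracker r)} {accept U} → All (Compatible ϱ) L →
                        (∀ a → Reflects (U a) (accept (summary L a))) →
                        Represents (trackerDFA {ϱ} L accept) U
trackerDFA-represents {L = L} {accept} {U} comps reflects = (λ ()) , correct
  where
  correct : ∀ x xs → DFA.accepts (trackerDFA L accept) (x ∷ xs) ⇔ U (decode x xs)
  correct x xs
    rewrite run-summary {L = L} accept comps xs (decode x []) | sym (decode-foldl x xs)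
    = reflects-≡true (reflects (decode x xs))

-- Saturation

clamp : ∀ k → ℤ → Fin (suc k)
clamp k (+ m)    = fromℕ< (s≤s (ℕ.m⊓n≤n m k))
clamp k -[1+ _ ] = zero

clamp-low : ∀ k {i} → i ≤ + 0 → clamp k i ≡ zero
clamp-low k {+ zero}    i≤0         = refl
clamp-low k {+ suc m}   (+≤+ ())
clamp-low k { -[1+ m ]} i≤0         = refl

clamp-high : ∀ k {i} → + k ≤ i → clamp k i ≡ fromℕ k
clamp-high k (+≤+ k≤m) = toℕ-injective
  (trans (toℕ-fromℕ< _) (trans (ℕ.m≥n⇒m⊓n≡n k≤m) (sym (toℕ-fromℕ k))))

toℕ-clamp : ∀ k {i} → + 0 ≤ i → i ≤ + k → + toℕ (clamp k i) ≡ i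
toℕ-clamp k {+ m} _ (+≤+ m≤k) = cong +_ (trans (toℕ-fromℕ< _) (ℕ.m≤n⇒m⊓n≡m m≤k))

-- The shift by `n` numbers the values from `-n` to `n` by 0 to `2n`; the two end classes also
-- absorb everything beyond.
saturation : ℕ → Abstraction
saturation n = record
  { size = suc (n ℕ.+ n)
  ; abs  = λ v → clamp (n ℕ.+ n) (v + + n)
  ; rep  = λ i → + toℕ i - + n
  }

module _ (n : ℕ) where

  private S = saturation n

  saturation-low : ∀ {v} → v ≤ - + n → abs S v ≡ zero
  saturation-low v≤-n = clamp-low (n ℕ.+ n)
    (ℤ.≤-trans (ℤ.+-monoˡ-≤ (+ n) v≤-n) (ℤ.≤-reflexive (ℤ.+-inverseˡ (+ n))))

  saturation-high : ∀ {v} → + n ≤ v → abs S v ≡ fromℕ (n ℕ.+ n)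
  saturation-high n≤v = clamp-high (n ℕ.+ n) (ℤ.+-monoˡ-≤ (+ n) n≤v)

  saturation-exact : ∀ {v} → - + n ≤ v → v ≤ + n → rep S (abs S v) ≡ v
  saturation-exact {v} -n≤v v≤n =
    trans (cong (_- + n) (toℕ-clamp (n ℕ.+ n)
            (ℤ.≤-trans (ℤ.≤-reflexive (sym (ℤ.+-inverseˡ (+ n)))) (ℤ.+-monoˡ-≤ (+ n) -n≤v))
            (ℤ.+-monoˡ-≤ (+ n) v≤n)))
          (cancel v (+ n))
    where
    cancel : ∀ v n → v + n - n ≡ v
    cancel = solve-∀

  -- Either nothing is lost, or `v` lies strictly beyond an endpoint that represents it.
  data Saturated (v : ℤ) : Set where
    exact : rep S (abs S v) ≡ v → Saturated v
    below : v < - + n → rep S (abs S v) ≡ - + n → Saturated v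
    above : + n < v → rep S (abs S v) ≡ + n → Saturated v

  saturated : ∀ v → Saturated v
  saturated v with v ℤ.<? - + n | + n ℤ.<? v
  ... | yes v<-n | _       = below v<-n
    (trans (cong (rep S) (saturation-low (ℤ.<⇒≤ v<-n))) (ℤ.+-identityˡ (- + n)))
  ... | no  _    | yes n<v = above n<v
    (trans (cong (rep S) (saturation-high (ℤ.<⇒≤ n<v)))
    (trans (cong (λ m → + m - + n) (toℕ-fromℕ (n ℕ.+ n))) (cancel (+ n))))
    where
    cancel : ∀ n → n + n - n ≡ n
    cancel = solve-∀
  ... | no v≮-n  | no n≮v  = exact (saturation-exact (ℤ.≮⇒≥ v≮-n) (ℤ.≮⇒≥ n≮v))

  -- Beyond the threshold, multiplying by 1 + c outweighs a letter of weight at most c n.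
  stays-low : ∀ c {v e} → e ≤ + c * + n → v ≤ - + n → + suc c * v + e ≤ - + n
  stays-low c e≤ v≤ = ℤ.≤-trans
    (ℤ.+-mono-≤ (ℤ.*-monoˡ-≤-nonNeg (+ suc c) v≤) e≤)
    (ℤ.≤-reflexive (collect (+ c) (+ n)))
    where
    collect : ∀ c n → (+ 1 + c) * - n + c * n ≡ - n
    collect = solve-∀

  stays-high : ∀ c {v e} → - (+ c * + n) ≤ e → + n ≤ v → + n ≤ + suc c * v + e
  stays-high c ≤e ≤v = ℤ.≤-trans
    (ℤ.≤-reflexive (collect (+ c) (+ n)))
    (ℤ.+-mono-≤ (ℤ.*-monoˡ-≤-nonNeg (+ suc c) ≤v) ≤e)
    where
    collect : ∀ c n → n ≡ (+ 1 + c) * n + - (c * n)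
    collect = solve-∀

  -- Beyond the threshold, `v` and its representative may differ, but the letter keeps both on their
  -- side, hence in the same end class.
  saturation-compatible : ∀ {c r} (t : Term r) → ‖ t ‖₊ ≤ + n → ‖ t ‖₋ ≤ + n →
                          Compatible (suc c) (S , t)
  saturation-compatible {c} t t₊≤n t₋≤n v y with saturated v
  ... | exact same = cong (λ s → abs S (+ suc c * s + weight t y)) same
  ... | below v<-n low = trans
    (saturation-low (stays-low c e≤ (ℤ.≤-reflexive low)))
    (sym (saturation-low (stays-low c e≤ (ℤ.<⇒≤ v<-n))))
    -- Only a positive weight can lead up from the low side, so `‖ t ‖₊` matters here, and `‖ t ‖₋`
    -- on the high side.
    where e≤ = ℤ.≤-trans (weight-≤ t y) (ℤ.*-monoˡ-≤-nonNeg (+ c) t₊≤n)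
  ... | above n<v high = trans
    (saturation-high (stays-high c ≤e (ℤ.≤-reflexive (sym high))))
    (sym (saturation-high (stays-high c ≤e (ℤ.<⇒≤ n<v))))
    where ≤e = ℤ.≤-trans (ℤ.neg-mono-≤ (ℤ.*-monoˡ-≤-nonNeg (+ c) t₋≤n)) (weight-≥ t y)

-- Comparisons with a constant

⟦_⟧ʳ? : ∀ ⋈ x y → Dec (⟦ ⋈ ⟧ʳ x y)
⟦ eq ⟧ʳ? x y = x ℤ.≟ y
⟦ ne ⟧ʳ? x y = ¬? (x ℤ.≟ y)
⟦ lt ⟧ʳ? x y = x ℤ.<? y
⟦ le ⟧ʳ? x y = x ℤ.≤? y
⟦ gt ⟧ʳ? x y = y ℤ.<? x
⟦ ge ⟧ʳ? x y = y ℤ.≤? x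

-- In each case `x` and `y` are ordered alike relative to `c`, which is all that a comparison with
-- `c` can see. The relation is symmetric, so one implication between comparisons gives both.
data SameSide (x y c : ℤ) : Set where
  equal : x ≡ y → SameSide x y c
  left  : x < c → y < c → SameSide x y c
  right : c < x → c < y → SameSide x y c

sameSide-sym : ∀ {x y c} → SameSide x y c → SameSide y x c
sameSide-sym (equal x≡y)     = equal (sym x≡y)
sameSide-sym (left x<c y<c)  = left y<c x<c
sameSide-sym (right c<x c<y) = right c<y c<x

⟦⟧ʳ-sameSide : ∀ ⋈ {x y c} → SameSide x y c → ⟦ ⋈ ⟧ʳ x c → ⟦ ⋈ ⟧ʳ y c
⟦⟧ʳ-sameSide _  (equal refl)    p = p
⟦⟧ʳ-sameSide eq (left x<c _)    p = contradiction p (ℤ.<⇒≢ x<c)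
⟦⟧ʳ-sameSide ne (left _ y<c)    _ = ℤ.<⇒≢ y<c
⟦⟧ʳ-sameSide lt (left _ y<c)    _ = y<c
⟦⟧ʳ-sameSide le (left _ y<c)    _ = ℤ.<⇒≤ y<c
⟦⟧ʳ-sameSide gt (left x<c _)    p = contradiction p (ℤ.<-asym x<c)
⟦⟧ʳ-sameSide ge (left x<c _)    p = contradiction x<c (ℤ.≤⇒≯ p)
⟦⟧ʳ-sameSide eq (right c<x _)   p = contradiction (sym p) (ℤ.<⇒≢ c<x)
⟦⟧ʳ-sameSide ne (right _ c<y)   _ = ℤ.<⇒≢ c<y ∘ sym
⟦⟧ʳ-sameSide lt (right c<x _)   p = contradiction p (ℤ.<-asym c<x)
⟦⟧ʳ-sameSide le (right c<x _)   p = contradiction c<x (ℤ.≤⇒≯ p)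
⟦⟧ʳ-sameSide gt (right _ c<y)   _ = c<y
⟦⟧ʳ-sameSide ge (right _ c<y)   _ = ℤ.<⇒≤ c<y

-- Since `c` lies strictly between `-n` and `n`, an endpoint that replaces a value beyond it is
-- still strictly on that value's side of `c`.
saturation-sameSide : ∀ n {c} v → - + n < c → c < + n →
                      SameSide (rep (saturation n) (abs (saturation n) v)) v c
saturation-sameSide n v -n<c c<n with saturated n v
... | exact same     = equal same
... | below v<-n low = left (ℤ.≤-<-trans (ℤ.≤-reflexive low) -n<c) (ℤ.<-trans v<-n -n<c)
... | above n<v high = right (ℤ.<-≤-trans c<n (ℤ.≤-reflexive (sym high))) (ℤ.<-trans c<n n<v)

-- Residues

-- The modulus is 1 + pred d, so that d = 0 needs no separate treatment.
residue : ℕ → Abstraction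
residue d = record
  { size = suc (ℕ.pred d)
  ; abs  = λ v → fromℕ< (n%ℕd<d v (suc (ℕ.pred d)))
  ; rep  = λ i → + toℕ i
  }

∣m-m%ℕd : ∀ v d .{{_ : ℕ.NonZero d}} → + d ∣ v - + (v %ℕ d)
∣m-m%ℕd v d = divides (v /ℕ d)
  (trans (cong (_- + (v %ℕ d)) (a≡a%ℕn+[a/ℕn]*n v d)) (cancel (+ (v %ℕ d)) ((v /ℕ d) * + d)))
  where
  cancel : ∀ r p → r + p - r ≡ p
  cancel = solve-∀

∣v-residue : ∀ d v → + suc (ℕ.pred d) ∣ v - rep (residue d) (abs (residue d) v)
∣v-residue d v = subst (λ i → + m ∣ v - + i) (sym (toℕ-fromℕ< (n%ℕd<d v m))) (∣m-m%ℕd v m)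
  where m = suc (ℕ.pred d)

-- The difference of the two remainders is a multiple of `d` and smaller than `d` in absolute value,
-- hence 0.
%ℕ-cong : ∀ x y d .{{_ : ℕ.NonZero d}} → + d ∣ x - y → x %ℕ d ≡ y %ℕ d
%ℕ-cong x y d d∣x-y with ∣ + (x %ℕ d) - + (y %ℕ d) ∣ in dist
... | zero  = ℤ.+-injective (ℤ.i-j≡0⇒i≡j _ _ (ℤ.∣i∣≡0⇒i≡0 dist))
... | suc k = contradiction (subst (d ℕ.∣_) dist (∣⇒∣ᵤ d∣r-s)) (ℕ.>⇒∤ (subst (ℕ._< d) dist near))
  where
  r = x %ℕ d
  s = y %ℕ d
  regroup : ∀ x y r s → x - y - (x - r) + (y - s) ≡ r - s
  regroup = solve-∀
  d∣r-s : + d ∣ + r - + s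
  d∣r-s = subst (+ d ∣_) (regroup x y (+ r) (+ s))
    (∣m∣n⇒∣m+n (∣m∣n⇒∣m-n d∣x-y (∣m-m%ℕd x d)) (∣m-m%ℕd y d))
  near : ∣ + r - + s ∣ ℕ.< d
  near = subst (λ z → ∣ z ∣ ℕ.< d) (sym (ℤ.m-n≡m⊖n r s))
    (ℕ.≤-<-trans (ℤ.∣m⊝n∣≤m⊔n r s) (ℕ.⊔-lub (n%ℕd<d x d) (n%ℕd<d y d)))

-- The two values to be compared differ by a multiple of `v - s`, which the modulus divides.
residue-compatible : ∀ {ϱ r} d (t : Term r) → Compatible ϱ (residue d , t)
residue-compatible {ϱ} d t v y = fromℕ<-cong (i %ℕ m) (j %ℕ m) (%ℕ-cong i j m m∣i-j) _ _
  where
  m = suc (ℕ.pred d)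
  e = weight t y
  s = rep (residue d) (abs (residue d) v)
  i = + ϱ * s + e
  j = + ϱ * v + e
  regroup : ∀ p v s e → (p * s + e) - (p * v + e) ≡ - p * (v - s)
  regroup = solve-∀
  m∣i-j : + m ∣ i - j
  m∣i-j = subst (+ m ∣_) (sym (regroup (+ ϱ) v s e)) (∣n⇒∣m*n (- + ϱ) (∣v-residue d v))

-- One residue decides divisibility for every shift `c`, so all atoms with the same `d` and `t`
-- share one tracker.
residue-∣ : ∀ d v c → d ≥ 1 → let s = rep (residue d) (abs (residue d) v) in
            (+ d ∣ s + c) ⇔ (+ d ∣ v + c)
-- Matching on `suc` lets the modulus `suc (pred d)` compute to `d`.
residue-∣ d@(suc _) v c _ = mk⇔
  (λ p → subst (+ d ∣_) (forth v s c) (∣m∣n⇒∣m+n (∣v-residue d v) p))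
  (λ p → subst (+ d ∣_) (back v s c) (∣m∣n⇒∣m-n p (∣v-residue d v)))
  where
  s = rep (residue d) (abs (residue d) v)
  forth : ∀ v s c → (v - s) + (s + c) ≡ v + c
  forth = solve-∀
  back : ∀ v s c → (v + c) - (v - s) ≡ s + c
  back = solve-∀

-- The automaton of a formula

module _ {r : ℕ} (T : List (Term r)) (D : List (ℕ × Term r)) (n : ℕ) where

  saturations residues trackers : List (Tracker r)
  saturations = map (saturation n ,_) T
  residues    = map (map₁ residue) D
  trackers    = saturations ++ residues

  ∈-saturations : ∀ {t} → t ∈ T → (saturation n , t) ∈ trackers
  ∈-saturations t∈T = ∈-++⁺ˡ (∈-map⁺ _ t∈T)

  ∈-residues : ∀ {d t} → (d , t) ∈ D → (residue d , t) ∈ trackers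
  ∈-residues dt∈D = ∈-++⁺ʳ saturations (∈-map⁺ _ dt∈D)

  -- The formula is evaluated with each term replaced by its representative. The recursion is on
  -- well-formedness because its membership proofs tell which tracker serves an atom.
  holds : ∀ {ψ} → WellFormed T D (+ n) ψ → Fin (states trackers) → Bool
  holds (cmp {⋈ = ⋈} {c} t∈T _ _) q = does (⟦ ⋈ ⟧ʳ? (observe (∈-saturations t∈T) q) c)
  holds (dvd {d} {c' = c} dt∈D)   q = does (+ d ∣? (observe (∈-residues dt∈D) q + c))
  holds (¬ᶠ w)    q = not (holds w q)
  holds (w ∧ᶠ w′) q = holds w q ∧ holds w′ q
  holds (w ∨ᶠ w′) q = holds w q ∨ holds w′ q

  holds-reflects : (∀ {d t} → (d , t) ∈ D → d ≥ 1) →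
                   ∀ {ψ} (w : WellFormed T D (+ n) ψ) a →
                   Reflects (a ⊨ ψ) (holds w (summary trackers a))
  holds-reflects _ (cmp {t} {⋈} {c} t∈T -n<c c<n) a
    rewrite observe-summary (∈-saturations t∈T) a
    -- `map′` carries the decision from the representative to the true value and keeps its Boolean,
    -- the one returned by `holds`.
    = proof (map′ (⟦⟧ʳ-sameSide ⋈ side) (⟦⟧ʳ-sameSide ⋈ (sameSide-sym side)) (⟦ ⋈ ⟧ʳ? _ c))
    where side = saturation-sameSide n (evalT t a) -n<c c<n
  holds-reflects d≥1 (dvd {d} {t} {c} dt∈D) a
    rewrite observe-summary (∈-residues dt∈D) a
    = proof (map′ (∣⇒∣ᵤ ∘ Equivalence.to equiv) (Equivalence.from equiv ∘ ∣ᵤ⇒∣) (+ d ∣? _))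
    where equiv = residue-∣ d (evalT t a) c (d≥1 dt∈D)
  holds-reflects d≥1 (¬ᶠ w)    a = ¬-reflects (holds-reflects d≥1 w a)
  holds-reflects d≥1 (w ∧ᶠ w′) a = holds-reflects d≥1 w a ×-reflects holds-reflects d≥1 w′ a
  holds-reflects d≥1 (w ∨ᶠ w′) a = holds-reflects d≥1 w a ⊎-reflects holds-reflects d≥1 w′ a

  trackers-compatible : ∀ {c} → (∀ {t} → t ∈ T → (‖ t ‖₊ < + n) × (‖ t ‖₋ < + n)) →
                        All (Compatible (suc c)) trackers
  trackers-compatible norms = ++⁺
    (map⁺ (All.tabulate λ {t} t∈T →
      saturation-compatible n t (ℤ.<⇒≤ (proj₁ (norms t∈T))) (ℤ.<⇒≤ (proj₂ (norms t∈T)))))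
    (map⁺ (All.tabulate λ {(d , t)} _ → residue-compatible d t))

-- The number of states

states-saturations : ∀ {r} n (T : List (Term r)) →
                     states (map (saturation n ,_) T) ≡ suc (n ℕ.+ n) ℕ.^ length T
states-saturations n []      = refl
states-saturations n (t ∷ T) = cong (suc (n ℕ.+ n) ℕ.*_) (states-saturations n T)

states-residues-≤ : ∀ {r} m (D : List (ℕ × Term r)) → (∀ {d t} → (d , t) ∈ D → d ℕ.< m) →
                    states (map (map₁ residue) D) ℕ.≤ m ℕ.^ length D
states-residues-≤ m []            _   = ℕ.≤-refl
states-residues-≤ m ((d , t) ∷ D) d<m = ℕ.*-mono-≤
  -- The chain is `suc (pred d) ≤ suc d ≤ m`, where the second inequality is `d < m`.
  (ℕ.≤-trans (s≤s ℕ.pred[n]≤n) (d<m (here refl)))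
  (states-residues-≤ m D (d<m ∘ there))

states-residues-> : ∀ {r} (D : List (ℕ × Term r)) → 0 ℕ.< states (map (map₁ residue) D)
states-residues-> []            = ℕ.≤-refl
states-residues-> ((d , t) ∷ D) = ℕ.*-mono-≤ {x = 1} {y = suc (ℕ.pred d)} (s≤s z≤n) (states-residues-> D)

^-<-suc^ : ∀ b {k} → 0 ℕ.< k → b ℕ.^ k ℕ.< suc b ℕ.^ k
^-<-suc^ b {suc k} _ = ℕ.^-monoˡ-< (suc k) (ℕ.n<1+n b)

suc-states-≤ : ∀ {r} n m (T : List (Term r)) (D : List (ℕ × Term r)) → T ≢ [] →
               (∀ {d t} → (d , t) ∈ D → d ℕ.< m) →
               suc (states (trackers T D n)) ℕ.≤ (2 ℕ.+ 2 ℕ.* n) ℕ.^ length T ℕ.* m ℕ.^ length D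
suc-states-≤ n m T D T≢[] d<m = begin
  suc (states (trackers T D n))
    ≡⟨ cong suc (trans (cong product (map-++ _ (saturations T D n) (residues T D n)))
                       (product-++ (map _ (saturations T D n)) _)) ⟩
  suc (states (saturations T D n) ℕ.* R)
    ≡⟨ cong (λ s → suc (s ℕ.* R)) (states-saturations n T) ⟩
  suc (B ℕ.^ length T ℕ.* R)
    -- As `R` is at least 1, the initial state is paid for by one further copy of `R`.
    ≤⟨ ℕ.+-monoˡ-≤ (B ℕ.^ length T ℕ.* R) (states-residues-> D) ⟩
  suc (B ℕ.^ length T) ℕ.* R
    ≤⟨ ℕ.*-mono-≤ (^-<-suc^ B (0<length T T≢[])) (states-residues-≤ m D d<m) ⟩
  suc B ℕ.^ length T ℕ.* m ℕ.^ length D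
    ≡⟨ cong (λ b → (2 ℕ.+ b) ℕ.^ length T ℕ.* m ℕ.^ length D)
            (cong (n ℕ.+_) (sym (ℕ.+-identityʳ n))) ⟩
  (2 ℕ.+ 2 ℕ.* n) ℕ.^ length T ℕ.* m ℕ.^ length D ∎
  where
  open ℕ.≤-Reasoning
  B = suc (n ℕ.+ n)
  R = states (residues T D n)
  0<length : ∀ {A : Set} (xs : List A) → xs ≢ [] → 0 ℕ.< length xs
  0<length []      xs≢[] = contradiction refl xs≢[]
  0<length (_ ∷ _) _     = s≤s z≤n

pos-^ : ∀ m k → (+ m) ^ k ≡ + (m ℕ.^ k)
pos-^ m zero    = refl
pos-^ m (suc k) = trans (cong (+ m *_) (pos-^ m k)) (sym (ℤ.pos-* m (m ℕ.^ k)))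

0≤‖_‖₊ : ∀ {r} (t : Term r) → + 0 ≤ ‖ t ‖₊
0≤‖ [] ‖₊           = ℤ.≤-refl
0≤‖ + k      ∷ t ‖₊ = ℤ.+-mono-≤ (+≤+ (z≤n {k})) 0≤‖ t ‖₊
0≤‖ -[1+ k ] ∷ t ‖₊ = ℤ.+-mono-≤ (ℤ.≤-refl {+ 0}) 0≤‖ t ‖₊

-- Nothing bounds ℓ′ from below when D is empty, but then the exponent is 0.
^-length : ∀ {r} ℓ′ (D : List (ℕ × Term r)) → (∀ {d t} → (d , t) ∈ D → + d < ℓ′) →
           ℓ′ ^ length D ≡ + (∣ ℓ′ ∣ ℕ.^ length D)
^-length ℓ′       []        _    = refl
^-length (+ m)    D@(_ ∷ _) _    = pos-^ m (length D)
^-length -[1+ _ ] (_ ∷ _)   d<ℓ′ = contradiction (d<ℓ′ (here refl)) λ ()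

theorem3p12 : (ϱ : ℕ) → ϱ ≥ 2 → (r : ℕ)
    → (T : List (Term r)) → Unique T → T ≢ []
    → (D : List (ℕ × Term r)) → Unique D → (∀ {d t} → (d , t) ∈ D → d ≥ 1)
    → (ℓ ℓ′ : ℤ)
    → (∀ {t} → t ∈ T → (‖ t ‖₊ < ℓ) × (‖ t ‖₋ < ℓ))
    → (∀ {d t} → (d , t) ∈ D → + d < ℓ′)
    → (ψ : Formula r) → WellFormed T D ℓ ψ
    → MinDFAStatesAtMost ϱ r (λ a → a ⊨ ψ)
    (((+ 2) + (+ 2) * ℓ) ^ length T * ℓ′ ^ length D)
theorem3p12 (suc c) _ r [] _ T≢[] = contradiction refl T≢[]
-- A norm is nonnegative, so a negative `ℓ` cannot exceed that of the head of `T`.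
theorem3p12 (suc c) _ r (t ∷ T) _ _ D _ _ -[1+ n ] ℓ′ norms =
  contradiction (ℤ.≤-<-trans 0≤‖ t ‖₊ (proj₁ (norms (here refl)))) λ ()
theorem3p12 (suc c) _ r T@(_ ∷ _) _ T≢[] D _ d≥1 (+ n) ℓ′ norms d<ℓ′ ψ wf =
    suc (states (trackers T D n))
  , trackerDFA (trackers T D n) (holds T D n wf)
  , trackerDFA-represents (trackers-compatible T D n norms) (holds-reflects T D n d≥1 wf)
  , subst (+ suc (states (trackers T D n)) ≤_) (sym bound≡)
      (+≤+ (suc-states-≤ n ∣ ℓ′ ∣ T D T≢[] (λ dt∈D → <-∣∣ (d<ℓ′ dt∈D))))
  where
  <-∣∣ : ∀ {d i} → + d < i → d ℕ.< ∣ i ∣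
  <-∣∣ (+<+ d<i) = d<i
  bound≡ : (+ 2 + + 2 * + n) ^ length T * ℓ′ ^ length D
           ≡ + ((2 ℕ.+ 2 ℕ.* n) ℕ.^ length T ℕ.* ∣ ℓ′ ∣ ℕ.^ length D)
  bound≡ = trans
    (cong₂ _*_ (trans (cong (λ i → (+ 2 + i) ^ length T) (sym (ℤ.pos-* 2 n)))
                      (pos-^ (2 ℕ.+ 2 ℕ.* n) (length T)))
               (^-length ℓ′ D d<ℓ′))
    (sym (ℤ.pos-* ((2 ℕ.+ 2 ℕ.* n) ℕ.^ length T) _))
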